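{- Let $G$ be a crossing closed graph on $[n]$. Then $G$ is upper crossing closed if and only if $G$ contains no obstruction as a subgraph.
   Context: Graphs are finite simple graphs with vertex set $[n]$; edges are written $ij$ with $i<j$. Two edges $a_1a_2$ and $b_1b_2$ cross if $a_1<b_1<a_2<b_2$ or $b_1<a_1<b_2<a_2$. Two crossing edges $e,f$ are crossing closed if among all induced connected subgraphs of $G$ containing $e$ and $f$ there is a unique minimal one under containment, denoted $J(e,f)$; $G$ is crossing closed if all pairs of crossing edges are. $G$ is upper crossing closed if it is crossing closed and there is a total order $\unlhd$ on $E(G)$ such that for every pair of crossing edges $e,f$, $J(e,f)$ contains an edge $h$ with $h\lhd e$ and $h\lhd f$. For crossing closed $G$, a subgraph $H$ of $G$ is an obstruction if for every edge $e$ of $H$ there is an edge $f$ of $H$ crossing $e$ with $J(e,f)\subseteq H$.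
   Formalization: An obstruction is required to have at least one edge; taken literally, every edgeless subgraph would be an obstruction vacuously and the equivalence would fail, for example for a single-vertex graph. -}

module Defs where

open import Data.Bool.Base using (Bool; T)
open import Data.Fin.Base using (Fin; _<_)
open import Data.Fin.Subset using (Subset; _∈_; _⊆_; Nonempty)
open import Data.Fin.Subset.Properties using (_∈?_)
open import Data.Nat.Base using (ℕ)
open import Data.Product using (∃; ∃!; Σ-syntax; ∃-syntax; _×_; _,_; proj₁)
open import Data.Sum using (_⊎_)
open import Level using (0ℓ)
open import Relation.Binary using (Rel; IsTotalOrder)
open import Relation.Binary.Construct.Closure.ReflexiveTransitive using (Star)
import Relation.Binary.Construct.NonStrictToStrict as NonStrictToStrict
open import Relation.Binary.PropositionalEquality using (_≡_)
open import Relation.Nullary using (¬_)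
open import Relation.Nullary.Decidable using (_×-dec_)
open import Relation.Unary using (Pred; Decidable)

record Graph (n : ℕ) : Set where
  field
    adj        : Fin n → Fin n → Bool
    adj-sym    : ∀ {i j} → T (adj i j) → T (adj j i)
    adj-irrefl : ∀ {i} → ¬ T (adj i i)

open Graph public

-- The fields lo<hi and isEdge are proof-irrelevant types, so two edges are
-- propositionally equal as soon as their endpoints agree.
record Edge {n : ℕ} (G : Graph n) : Set where
  field
    lo hi  : Fin n
    lo<hi  : lo < hi
    isEdge : T (adj G lo hi)

open Edge public

record Subgraph {n : ℕ} (G : Graph n) : Set₁ where
  field
    V    : Subset n
    E    : Pred (Edge G) 0ℓ
    E?   : Decidable E
    ends : ∀ {e} → E e → lo e ∈ V × hi e ∈ V

open Subgraph public

module _ {n : ℕ} {G : Graph n} where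

  infix 4 _⊑_

  _⊑_ : Subgraph G → Subgraph G → Set
  H ⊑ K = V H ⊆ V K × (∀ {e} → E H e → E K e)

  Adjacent : Subgraph G → Rel (Fin n) 0ℓ
  Adjacent H u v =
    ∃[ e ] E H e × ((lo e ≡ u × hi e ≡ v) ⊎ (lo e ≡ v × hi e ≡ u))

  Connected : Subgraph G → Set
  Connected H =
    Nonempty (V H) × (∀ {u v} → u ∈ V H → v ∈ V H → Star (Adjacent H) u v)

  Crossing : Rel (Edge G) 0ℓ
  Crossing a b = (lo a < lo b × lo b < hi a × hi a < hi b)
               ⊎ (lo b < lo a × lo a < hi b × hi b < hi a)

module _ {n : ℕ} (G : Graph n) where

  induced : Subset n → Subgraph G
  induced S = record
    { V    = S
    ; E    = λ e → lo e ∈ S × hi e ∈ S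
    ; E?   = λ e → (lo e ∈? S) ×-dec (hi e ∈? S)
    ; ends = λ p → p
    }

  -- Induced subgraphs are indexed by their vertex sets.
  ConnectedContaining : Edge G → Edge G → Pred (Subset n) 0ℓ
  ConnectedContaining e f S =
    Connected (induced S) × E (induced S) e × E (induced S) f

  MinimalConnectedContaining : Edge G → Edge G → Pred (Subset n) 0ℓ
  MinimalConnectedContaining e f S =
    ConnectedContaining e f S ×
    (∀ {S′} → ConnectedContaining e f S′ →
      induced S′ ⊑ induced S → induced S ⊑ induced S′)

  CrossingClosed : Set
  CrossingClosed =
    ∀ e f → Crossing e f → ∃! _≡_ (MinimalConnectedContaining e f)

module _ {n : ℕ} {G : Graph n} (cc : CrossingClosed G) where

  J : (e f : Edge G) → Crossing e f → Subgraph G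
  J e f c = induced G (proj₁ (cc e f c))

  -- An obstruction is required to have an edge: the condition on edges is
  -- vacuous for an edgeless subgraph.
  IsObstruction : Pred (Subgraph G) 0ℓ
  IsObstruction H =
    ∃ (E H) ×
    (∀ e → E H e →
      ∃[ f ] E H f × (Σ[ c ∈ Crossing e f ] J e f c ⊑ H))

UpperCrossingClosed : ∀ {n} → Graph n → Set₁
UpperCrossingClosed G =
  Σ[ cc ∈ CrossingClosed G ]
  Σ[ _⊴_ ∈ Rel (Edge G) 0ℓ ]
    let open NonStrictToStrict _≡_ _⊴_ using () renaming (_<_ to _⊲_) in
    IsTotalOrder _≡_ _⊴_ ×
    (∀ e f (c : Crossing e f) →
      ∃[ h ] E (J cc e f c) h × h ⊲ e × h ⊲ f)

{-# OPTIONS --safe #-}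

-- If ⊴ witnesses upper crossing closedness, the ⊴-least edge e of an
-- obstruction H crosses some f with J(e,f) ⊆ H, and J(e,f) has an edge below e,
-- contradicting minimality.  Conversely, without obstructions every nonempty
-- set S of edges has an edge e such that no f in S crosses e with J(e,f) ⊆ S.
-- Removing such edges one after the other and ordering E(G) by time of removal,
-- the first edge of J(e,f) to go is neither e nor f, so it precedes both.

module Submission where

open import Data.Bool.Properties using (T-irrelevant)
open import Data.Fin.Base using (Fin)
import Data.Fin.Properties as Fin
open import Data.Fin.Subset using (⊤)
open import Data.Fin.Subset.Properties using (∈⊤)
open import Data.List.Base
  using (List; []; _∷_; length; filter; concatMap; cartesianProduct; allFin)
import Data.List.Extrema as Extrema
open import Data.List.Membership.Propositional using (_∈_; find; lose)
open import Data.List.Membership.Propositional.Properties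
  using (∈-concatMap⁺; ∈-cartesianProduct⁺; ∈-allFin; ∈-filter⁺)
open import Data.List.Properties using (filter-notAll)
open import Data.List.Relation.Unary.All as All using (All)
open import Data.List.Relation.Unary.All.Properties using (all-filter; ¬All⇒Any¬)
open import Data.List.Relation.Unary.Any as Any using (Any; here)
open import Data.Nat.Base as ℕ using (ℕ; suc; z<s; s<s)
open import Data.Nat.Induction using (Acc; acc; <-wellFounded)
import Data.Nat.Properties as ℕ
open import Data.Product using (∃; ∃-syntax; Σ-syntax; _×_; _,_; proj₁; proj₂)
import Data.Sum as Sum
open import Function.Base using (id; _∘_; _on_)
open import Function.Bundles using (_⇔_; mk⇔)
open import Level using (0ℓ)
open import Relation.Binary
  using (Rel; IsTotalOrder; TotalOrder; DecidableEquality)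
open import Relation.Binary.PropositionalEquality
  using (_≡_; _≢_; refl; sym; cong; subst; isEquivalence)
open import Relation.Nullary using (¬_; Dec; yes; no; contradiction)
open import Relation.Nullary.Decidable
  using (map′; _×-dec_; _⊎-dec_; _→-dec_; ¬?; T?)
import Relation.Unary as U
open import Defs

on-isTotalOrder : {A : Set} (r : A → ℕ) → (∀ {x y} → r x ≡ r y → x ≡ y) →
                  IsTotalOrder _≡_ (ℕ._≤_ on r)
on-isTotalOrder r r-injective = record
  { isPartialOrder = record
    { isPreorder = record
      { isEquivalence = isEquivalence
      ; reflexive     = ℕ.≤-reflexive ∘ cong r
      ; trans         = ℕ.≤-trans
      }
    ; antisym = λ p q → r-injective (ℕ.≤-antisym p q)
    }
  ; total = λ x y → ℕ.≤-total (r x) (r y)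
  }

module _ {n : ℕ} {G : Graph n} where

  -- Decidable equality and enumeration of edges

  Edge-≡ : {e f : Edge G} → lo e ≡ lo f → hi e ≡ hi f → e ≡ f
  Edge-≡ {record { lo<hi = p ; isEdge = a }} {record { lo<hi = q ; isEdge = b }}
         refl refl
    with refl ← Fin.<-irrelevant p q | refl ← T-irrelevant a b = refl

  infix 4 _≟_ _∈?_

  _≟_ : DecidableEquality (Edge G)
  e ≟ f = map′ (λ (p , q) → Edge-≡ p q) (λ { refl → refl , refl })
               ((lo e Fin.≟ lo f) ×-dec (hi e Fin.≟ hi f))

  _∈?_ : (e : Edge G) (xs : List (Edge G)) → Dec (e ∈ xs)
  e ∈? xs = Any.any? (e ≟_) xs

  edgesBetween : Fin n × Fin n → List (Edge G)
  edgesBetween (i , j) with i Fin.<? j | T? (adj G i j)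
  ... | yes p | yes a = record { lo<hi = p ; isEdge = a } ∷ []
  ... | _     | _     = []

  ∈-edgesBetween : ∀ e → e ∈ edgesBetween (lo e , hi e)
  ∈-edgesBetween e with lo e Fin.<? hi e | T? (adj G (lo e) (hi e))
  -- The proofs found by the decision procedures need not be the fields of `e`, but edges ignore the
  -- difference.
  ... | yes _ | yes _ = here (Edge-≡ refl refl)
  ... | no ¬p | _     = contradiction (lo<hi e) ¬p
  ... | yes _ | no ¬a = contradiction (isEdge e) ¬a

  edges : List (Edge G)
  edges = concatMap edgesBetween (cartesianProduct (allFin n) (allFin n))

  ∈-edges : ∀ e → e ∈ edges
  ∈-edges e = ∈-concatMap⁺ edgesBetween
    (lose (∈-cartesianProduct⁺ (∈-allFin (lo e)) (∈-allFin (hi e)))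
          (∈-edgesBetween e))

  all? : {P : U.Pred (Edge G) 0ℓ} → U.Decidable P → Dec (∀ e → P e)
  all? P? = map′ (λ ps e → All.lookup ps (∈-edges e)) (λ p → All.universal p edges)
                 (All.all? P? edges)

  crossing? : (e f : Edge G) → Dec (Crossing e f)
  crossing? e f =
    ((lo e Fin.<? lo f) ×-dec (lo f Fin.<? hi e) ×-dec (hi e Fin.<? hi f))
    ⊎-dec
    ((lo f Fin.<? lo e) ×-dec (lo e Fin.<? hi f) ×-dec (hi f Fin.<? hi e))

  crossing-sym : (e f : Edge G) → Crossing e f → Crossing f e
  crossing-sym _ _ = Sum.swap

  minimal-sym : ∀ e f {S} → MinimalConnectedContaining G e f S →
                MinimalConnectedContaining G f e S
  minimal-sym _ _ ((conn , e∈S , f∈S) , least) =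
    (conn , f∈S , e∈S) , λ (conn′ , f∈S′ , e∈S′) → least (conn′ , e∈S′ , f∈S′)

  -- An obstruction is wanted here only for its edges; with every vertex included, the vertex half
  -- of `_⊑_` holds trivially.
  spanning : List (Edge G) → Subgraph G
  spanning xs = record { V = ⊤ ; E = _∈ xs ; E? = _∈? xs ; ends = λ _ → ∈⊤ , ∈⊤ }

  infix 4 _⊆ᴱ_ _⊆ᴱ?_

  _⊆ᴱ_ : Subgraph G → List (Edge G) → Set
  H ⊆ᴱ xs = ∀ h → E H h → h ∈ xs

  _⊆ᴱ?_ : ∀ H xs → Dec (H ⊆ᴱ xs)
  H ⊆ᴱ? xs = all? λ h → E? H h →-dec (h ∈? xs)

  infixl 6 _∖_

  _∖_ : List (Edge G) → Edge G → List (Edge G)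
  xs ∖ a = filter (λ e → ¬? (e ≟ a)) xs

  ∈-∖⁺ : ∀ {e a xs} → e ∈ xs → e ≢ a → e ∈ xs ∖ a
  ∈-∖⁺ = ∈-filter⁺ (λ e → ¬? (e ≟ _))

  length-∖ : ∀ {a xs} → a ∈ xs → length (xs ∖ a) ℕ.< length xs
  length-∖ {a} {xs} a∈xs =
    filter-notAll (λ e → ¬? (e ≟ a)) xs (lose a∈xs (λ a≢a → a≢a refl))

  -- Removal of edges in a crossing closed graph

  module _ (cc : CrossingClosed G) where

    J-minimal : ∀ e f c → MinimalConnectedContaining G e f (V (J cc e f c))
    J-minimal e f c = proj₁ (proj₂ (cc e f c))

    -- `J` formally depends on `cc` and on the crossing proof; uniqueness of the minimal vertex set
    -- removes both dependences and also yields symmetry in `e` and `f`.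
    J-unique : ∀ e f {S} c → MinimalConnectedContaining G e f S →
               J cc e f c ≡ induced G S
    J-unique e f c m = cong (induced G) (proj₂ (proj₂ (cc e f c)) m)

    left∈J : ∀ e f c → E (J cc e f c) e
    left∈J e f c = let (_ , e∈J , _) , _ = J-minimal e f c in e∈J

    J-sym : ∀ e f c → J cc f e (crossing-sym e f c) ≡ J cc e f c
    J-sym e f c = J-unique f e (crossing-sym e f c) (minimal-sym e f (J-minimal e f c))

    right∈J : ∀ e f c → E (J cc e f c) f
    right∈J e f c = let (_ , _ , f∈J) , _ = J-minimal e f c in f∈J

    -- The obstacle to removing `e` next when `xs` are the edges left. The form with `Any` lets it
    -- be decided by searching `xs`.
    Blocked : List (Edge G) → Edge G → Set
    Blocked xs e = Any (λ f → Σ[ c ∈ Crossing e f ] J cc e f c ⊆ᴱ xs) xs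

    blocked? : ∀ xs → U.Decidable (Blocked xs)
    blocked? xs e = Any.any? dec xs
      where
      dec : ∀ f → Dec (Σ[ c ∈ Crossing e f ] J cc e f c ⊆ᴱ xs)
      dec f with crossing? e f
      ... | no ¬c = no (¬c ∘ proj₁)
      ... | yes c = map′ (c ,_)
        -- The given crossing proof `c′` need not be the decided `c`; `J` is the same for both.
        (λ (c′ , p) → subst (_⊆ᴱ xs) (J-unique e f c′ (J-minimal e f c)) p)
        (J cc e f c ⊆ᴱ? xs)

    all-blocked⇒obstruction : ∀ {x xs} → All (Blocked (x ∷ xs)) (x ∷ xs) →
                              IsObstruction cc (spanning (x ∷ xs))
    all-blocked⇒obstruction {x} bs = (x , here refl) , λ e e∈xs →
      let f , f∈xs , c , p = find (All.lookup bs e∈xs)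
      in  f , f∈xs , c , (λ _ → ∈⊤) , λ {h} → p h

    -- Decidability of `Blocked` turns the failure of `All` into an actual edge that can be removed.
    obstruction-free⇒unblocked :
      ¬ (∃ λ H → IsObstruction cc H) → ∀ x xs →
      ∃[ e ] e ∈ x ∷ xs × ¬ Blocked (x ∷ xs) e
    obstruction-free⇒unblocked free x xs =
      find (¬All⇒Any¬ (blocked? (x ∷ xs)) (x ∷ xs)
             (λ bs → free (spanning (x ∷ xs) , all-blocked⇒obstruction bs)))

    -- The induction hypothesis for removal, with `rank` as the time of removal. Only pairs with `J`
    -- inside `xs` are constrained; when `xs` lists all edges, these are all crossing pairs.
    record Ranking (xs : List (Edge G)) : Set where
      field
        rank      : Edge G → ℕ
        injective : ∀ {e f} → e ∈ xs → f ∈ xs → rank e ≡ rank f → e ≡ f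
        upper     : ∀ e f c → J cc e f c ⊆ᴱ xs →
                    ∃[ h ] E (J cc e f c) h × rank h ℕ.< rank e × rank h ℕ.< rank f

    module _ {xs a} (a-unblocked : ¬ Blocked xs a)
             (R : Ranking (xs ∖ a)) where

      open Ranking R

      -- `a` is removed first, at time 0, and every other removal is delayed by one.
      rank⁺ : Edge G → ℕ
      rank⁺ e with e ≟ a
      ... | yes _ = 0
      ... | no  _ = suc (rank e)

      rank⁺-injective : ∀ {e f} → e ∈ xs → f ∈ xs → rank⁺ e ≡ rank⁺ f → e ≡ f
      rank⁺-injective {e} {f} e∈xs f∈xs eq with e ≟ a | f ≟ a
      ... | yes refl | yes refl = refl
      ... | no e≢a   | no f≢a   =
        injective (∈-∖⁺ e∈xs e≢a) (∈-∖⁺ f∈xs f≢a) (ℕ.suc-injective eq)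

      rank⁺-a : ∀ {e} → e ≢ a → rank⁺ a ℕ.< rank⁺ e
      rank⁺-a {e} e≢a with a ≟ a | e ≟ a
      ... | no a≢a | _       = contradiction refl a≢a
      ... | yes _  | yes e≡a = contradiction e≡a e≢a
      ... | yes _  | no _    = z<s

      rank⁺-mono-< : ∀ {e f} → f ≢ a → rank e ℕ.< rank f → rank⁺ e ℕ.< rank⁺ f
      rank⁺-mono-< {e} {f} f≢a e<f with e ≟ a | f ≟ a
      ... | _     | yes f≡a = contradiction f≡a f≢a
      ... | yes _ | no _    = z<s
      ... | no _  | no _    = s<s e<f

      -- Since `f` lies in `J`, it lies in `xs`; were `e` equal to `a`, then `f` would block `a`.
      left≢a : ∀ e f c → J cc e f c ⊆ᴱ xs → e ≢ a
      left≢a e f c J⊆xs refl =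
        a-unblocked (lose (J⊆xs f (right∈J e f c)) (c , J⊆xs))

      -- `Blocked` concerns the first edge of a pair, so the pair is swapped by the symmetry of `J`.
      right≢a : ∀ e f c → J cc e f c ⊆ᴱ xs → f ≢ a
      right≢a e f c J⊆xs =
        left≢a f e (crossing-sym e f c) (subst (_⊆ᴱ xs) (sym (J-sym e f c)) J⊆xs)

      rank⁺-upper : ∀ e f c → J cc e f c ⊆ᴱ xs →
        ∃[ h ] E (J cc e f c) h × rank⁺ h ℕ.< rank⁺ e × rank⁺ h ℕ.< rank⁺ f
      rank⁺-upper e f c J⊆xs with E? (J cc e f c) a
      -- Here `a` itself, of new rank 0, is the first edge of `J` to go.
      ... | yes a∈J =
        a , a∈J , rank⁺-a (left≢a e f c J⊆xs) , rank⁺-a (right≢a e f c J⊆xs)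
      -- All of `J` survives the removal of `a`, so the edge supplied by the smaller ranking still
      -- works.
      ... | no  a∉J =
        let h , h∈J , h<e , h<f = upper e f c
              (λ h h∈J → ∈-∖⁺ (J⊆xs h h∈J) (λ { refl → a∉J h∈J }))
        in  h , h∈J , rank⁺-mono-< (left≢a e f c J⊆xs) h<e
                    , rank⁺-mono-< (right≢a e f c J⊆xs) h<f

      extend : Ranking xs
      extend = record
        { rank = rank⁺ ; injective = rank⁺-injective ; upper = rank⁺-upper }

    obstruction-free⇒ranking : ¬ (∃ λ H → IsObstruction cc H) → ∀ xs → Ranking xs
    obstruction-free⇒ranking free xs = go xs (<-wellFounded (length xs))
      where
      go : ∀ xs → Acc ℕ._<_ (length xs) → Ranking xs
      go [] _ = record
        { rank      = λ _ → 0
        ; injective = λ ()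
        -- `J` contains `e`, so it never fits inside the empty list.
        ; upper     = λ e f c J⊆[] → contradiction (J⊆[] e (left∈J e f c)) λ ()
        }
      -- The removed edge may sit anywhere in the list, so the recursion is on length rather than on
      -- the tail.
      go (x ∷ xs) (acc rs) =
        let a , a∈ , a-unblocked = obstruction-free⇒unblocked free x xs
        in  extend a-unblocked (go ((x ∷ xs) ∖ a) (rs (length-∖ a∈)))

    ranking⇒upperCrossingClosed : Ranking edges → UpperCrossingClosed G
    ranking⇒upperCrossingClosed R = cc , (ℕ._≤_ on rank) ,
      on-isTotalOrder rank (injective (∈-edges _) (∈-edges _)) ,
      λ e f c →
        let h , h∈J , h<e , h<f = upper e f c (λ h _ → ∈-edges h)
        in  h , h∈J , strict h<e , strict h<f
      where
      open Ranking R
      strict : ∀ {e f} → rank e ℕ.< rank f → rank e ℕ.≤ rank f × e ≢ f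
      strict e<f = ℕ.<⇒≤ e<f , λ { refl → ℕ.<-irrefl refl e<f }

  -- Least edges and the exclusion of obstructions

  least-edge : {_⊴_ : Rel (Edge G) 0ℓ} → IsTotalOrder _≡_ _⊴_ →
               ∀ H → ∃ (E H) → ∃[ e ] E H e × (∀ {h} → E H h → e ⊴ h)
  least-edge {_⊴_} to H (e₀ , e₀∈H) =
    -- `e₀` is the default value of the minimum; as it lies in `H` along with all filtered edges, so
    -- does the result.
    min e₀ H-edges , argmin-all id e₀∈H (all-filter (E? H) edges) ,
    λ h∈H → All.lookup (min≤xs e₀ H-edges) (∈-filter⁺ (E? H) (∈-edges _) h∈H)
    where
    O : TotalOrder 0ℓ 0ℓ 0ℓ
    O = record { isTotalOrder = to }
    open Extrema O using (min; min≤xs; argmin-all)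
    H-edges : List (Edge G)
    H-edges = filter (E? H) edges

  upperCrossingClosed⇒obstruction-free : ∀ cc →
    UpperCrossingClosed G → ¬ (∃ λ H → IsObstruction cc H)
  upperCrossingClosed⇒obstruction-free cc (cc′ , _ , to , upper)
                                       (H , nonempty , closed) =
    let e , e∈H , e-least        = least-edge to H nonempty
        f , _ , c , _ , J⊆H      = closed e e∈H
        h , h∈J , (h⊴e , h≢e) , _ = upper e f c
        -- `cc′` comes with the order and may differ from `cc`; uniqueness identifies the two
        -- versions of `J`.
        h∈H = J⊆H (subst (λ K → E K h) (J-unique cc′ e f c (J-minimal cc e f c)) h∈J)
    in  h≢e (IsTotalOrder.antisym to h⊴e (e-least h∈H))

theoremA4 : (n : ℕ) (G : Graph n) (cc : CrossingClosed G) →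
    UpperCrossingClosed G ⇔ (¬ (∃ λ (H : Subgraph G) → IsObstruction cc H))
theoremA4 n G cc = mk⇔
  (upperCrossingClosed⇒obstruction-free cc)
  (λ free → ranking⇒upperCrossingClosed cc (obstruction-free⇒ranking cc free edges))
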